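{- For every connected weighted undirected graph $G$ with skeleton dimension $\kappa$ and max leaf number $ml$ we have $\kappa \leq ml$. Moreover, for every connected unweighted undirected graph $G$ on $n \geq 3$ nodes there are metric edge weights for $G$ such that the skeleton dimension $\kappa$ of the resulting weighted graph equals the max leaf number $ml$ of $G$.
   Context: Graphs $G=(V,E)$ are finite, simple, undirected and connected; edge weights are given by a function $\ell\colon E\to\mathbb{Q}^+$ (positive rationals), and $\dist_G(u,v)$ (written $\mathrm{dist}_G(u,v)$) is the length of the shortest path from $u$ to $v$. Standing assumption: in weighted graphs the shortest path between any two nodes is unique. A weighted graph is metric if its edge weights satisfy the triangle inequality, i.e. $\ell(\{u,v\})=\mathrm{dist}_G(u,v)$ for every edge $\{u,v\}\in E$. Geometric realization: $\tilde G=(\tilde V,\tilde E)$ is the continuous version of $G$ in which every edge $\{u,v\}$ is replaced by a segment of length $\ell(\{u,v\})$; thus $V\subseteq\tilde V$, distances between nodes of $V$ are unchanged, and for every edge $\{u,v\}$ and $0\le\alpha\le\ell(\{u,v\})$ there is a point $w\in\tilde V$ on it with $\mathrm{dist}(u,w)=\alpha$ and $\mathrm{dist}(w,v)=\ell(\{u,v\})-\alpha$. Skeleton dimension: for $s\in V$ let $T_s$ be the shortest path tree of $s$ and $\tilde T_s$ its geometric realization. The skeleton $T_s^*$ is the subtree of $\tilde T_s$ induced by all points $v$ that have a descendant $w$ in $\tilde T_s$ (rooted at $s$) with $\mathrm{dist}(v,w)\ge\frac12\mathrm{dist}(s,v)$. For $r\ge 0$, $\mathrm{Cut}_s^r$ is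 the set of all points $u$ of $T_s^*$ with $\mathrm{dist}(s,u)=r$. The skeleton dimension of $G$ is $\kappa=\max_{s,r}|\mathrm{Cut}_s^r|$. Max leaf number: $ml$ is the maximum number of leaves of all spanning trees of $G$ (edge weights are ignored). -}

module Defs where

open import Data.Fin using (Fin)
open import Data.List using (List; []; _∷_; length)
open import Data.List.Membership.Propositional using (_∈_)
open import Data.List.Relation.Unary.Unique.Propositional using (Unique)
open import Data.Nat using (ℕ)
import Data.Nat as ℕ
open import Data.Product using (Σ-syntax; ∃-syntax; _×_)
open import Data.Rational using (ℚ; 0ℚ; ½; _+_; _-_; _*_; _≤_; _<_)
open import Function.Bundles using (_⇔_)
open import Level using (Level; 0ℓ; _⊔_)
open import Relation.Binary using (Rel; Symmetric; Irreflexive; Decidable)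
open import Relation.Binary.Construct.Closure.ReflexiveTransitive using (Star; ε; _◅_; _◅◅_)
open import Relation.Binary.PropositionalEquality using (_≡_)
open import Relation.Nullary using (¬_)

HasSize : ∀ {a p : Level} {A : Set a} → (A → Set p) → ℕ → Set (a ⊔ p)
HasSize {A = A} P k =
  Σ[ xs ∈ List A ] (Unique xs × (∀ x → x ∈ xs ⇔ P x) × length xs ≡ k)

record Graph (n : ℕ) : Set₁ where
  infix 4 _~_ _~?_
  field
    _~_    : Rel (Fin n) 0ℓ
    ~-sym  : Symmetric _~_
    ~-irr  : Irreflexive _≡_ _~_
    _~?_   : Decidable _~_

Walk : ∀ {n} → Graph n → Rel (Fin n) 0ℓ
Walk G = Star (Graph._~_ G)

module _ {n : ℕ} (G : Graph n) where
  open Graph G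

  Connected : Set
  Connected = ∀ u v → Walk G u v

  vertices : ∀ {u v} → Walk G u v → List (Fin n)
  vertices {u} ε       = u ∷ []
  vertices {u} (_ ◅ p) = u ∷ vertices p

  Cyclic : Set
  Cyclic = ∃[ u ] ∃[ v ] Σ[ p ∈ Walk G u v ]
    (Unique (vertices p) × 3 ℕ.≤ length (vertices p) × v ~ u)

  IsTree : Set
  IsTree = Connected × ¬ Cyclic

  -- Degree at most one: in a tree with at least two vertices this is degree
  -- exactly one, and the only vertex of a one-vertex tree counts as a leaf.
  Leaf : Fin n → Set
  Leaf v = ∃[ d ] (HasSize (v ~_) d × d ℕ.≤ 1)

_⊆_ : ∀ {n} → Graph n → Graph n → Set
T ⊆ G = ∀ {u v} → Graph._~_ T u v → Graph._~_ G u v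

IsSpanningTree : ∀ {n} → Graph n → Graph n → Set
IsSpanningTree G T = T ⊆ G × IsTree T

IsMaxLeafNumber : ∀ {n} → Graph n → ℕ → Set₁
IsMaxLeafNumber {n} G m =
    (Σ[ T ∈ Graph n ] (IsSpanningTree G T × HasSize (Leaf T) m))
  × (∀ (T : Graph n) k → IsSpanningTree G T → HasSize (Leaf T) k → k ℕ.≤ m)

-- The values of ℓ on pairs that are not edges are never used.
record Weights {n : ℕ} (G : Graph n) : Set where
  open Graph G
  field
    ℓ     : Fin n → Fin n → ℚ
    ℓ-sym : ∀ {u v} → u ~ v → ℓ u v ≡ ℓ v u
    ℓ-pos : ∀ {u v} → u ~ v → 0ℚ < ℓ u v

module _ {n : ℕ} {G : Graph n} (W : Weights G) where
  open Graph G
  open Weights W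

  weight : ∀ {u v} → Walk G u v → ℚ
  weight ε                 = 0ℚ
  weight (_◅_ {u} {v} _ p) = ℓ u v + weight p

  -- Since weights are positive, a shortest walk never repeats a vertex, so
  -- shortest walks are exactly shortest paths.
  Shortest : ∀ {u v} → Walk G u v → Set
  Shortest {u} {v} p = ∀ (q : Walk G u v) → weight p ≤ weight q

  Dist : Fin n → Fin n → ℚ → Set
  Dist u v d = Σ[ p ∈ Walk G u v ] (Shortest p × weight p ≡ d)

  UniqueShortestPaths : Set
  UniqueShortestPaths = ∀ {u v} (p q : Walk G u v) →
    Shortest p → Shortest q → vertices G p ≡ vertices G q

  IsMetric : Set
  IsMetric = ∀ {u v} → u ~ v → Dist u v (ℓ u v)

  module _ (s : Fin n) where

    -- The edges of the shortest path tree of s, directed away from s: u is the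
    -- last vertex before v on a shortest path from s to v.
    Arc : Fin n → Fin n → Set
    Arc u v = Σ[ p ∈ Walk G s u ] Σ[ e ∈ u ~ v ] Shortest (p ◅◅ e ◅ ε)

    -- Points of the geometric realization of the shortest path tree; inner u v α
    -- lies strictly inside the segment from u to v, at distance α from u.  The
    -- proofs are irrelevant so that _≡_ is equality of points.  Only rational
    -- positions are considered: for r > 0 the size of Cut r is constant on
    -- half-open intervals (a , b] with rational endpoints, so admitting real
    -- positions and radii would not change its maximum.
    data Point : Set where
      node  : Fin n → Point
      inner : (u v : Fin n) (α : ℚ) →
              .(Arc u v) → .(0ℚ < α) → .(α < ℓ u v) → Point

    data OnSegment (u v : Fin n) : Point → ℚ → Set where
      start  : OnSegment u v (node u) 0ℚ
      inside : ∀ {α} .{a : Arc u v} .{l : 0ℚ < α} .{r : α < ℓ u v} →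
               OnSegment u v (inner u v α a l r) α
      end    : OnSegment u v (node v) (ℓ u v)

    -- Descent x y d: the point y is a descendant of x (or x itself), and the path
    -- from x down to y has length d.  It is the only path between the two
    -- in the tree, so d is their distance; for x = node s this is the distance
    -- from the root.
    data Descent (x : Point) : Point → ℚ → Set where
      stay : Descent x x 0ℚ
      move : ∀ {y z d u v α β} → Descent x y d → Arc u v →
             OnSegment u v y α → OnSegment u v z β → α ≤ β →
             Descent x z (d + (β - α))

    InSkeleton : Point → Set
    InSkeleton x = ∃[ r ] (Descent (node s) x r ×
      ∃[ y ] ∃[ d ] (Descent x y d × ½ * r ≤ d))

    Cut : ℚ → Point → Set
    Cut r x = InSkeleton x × Descent (node s) x r

  IsSkeletonDimension : ℕ → Set
  IsSkeletonDimension κ =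
      (∃[ s ] ∃[ r ] (0ℚ ≤ r × HasSize (Cut s r) κ))
    × (∀ s r k → 0ℚ ≤ r → HasSize (Cut s r) k → k ℕ.≤ κ)

{-# OPTIONS --safe #-}
module Submission where

-- Upper bound: every point of a shortest path tree has a leaf of the tree below it, and two
-- points at the same distance from the root above the same leaf coincide, so no cut has more
-- points than the tree has leaves.
--
-- Equality: in a spanning tree T with the maximum number of leaves, give every leaf a large and
-- every internal vertex a small weight, and let an edge weigh the sum of its ends. Such weights
-- are metric, and the shortest paths from an internal vertex of T are short until they leave
-- for a leaf of T. Taking distinct powers of two as vertex weights makes shortest paths unique.

open import Defs
import Algebra.Properties.Group as Group
open import Data.Bool using (Bool; true; false)
open import Data.Fin using (Fin; zero; suc; toℕ)
open import Data.Fin.Induction using (spo-noetherian)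
import Data.Fin.Properties as Fin
open import Data.List
  using (List; []; _∷_; _++_; _∷ʳ_; length; map; filter; lookup; allFin; concatMap)
import Data.List.Membership.DecPropositional as DecMembership
open import Data.List.Membership.Propositional using (_∈_; _∉_)
import Data.List.Membership.Propositional.Properties as ∈
import Data.List.Properties as List
open import Data.List.Relation.Unary.All as All using (All; []; _∷_)
open import Data.List.Relation.Unary.All.Properties as All using (All¬⇒¬Any; ¬Any⇒All¬)
open import Data.List.Relation.Unary.AllPairs using ([]; _∷_)
open import Data.List.Relation.Unary.Any as Any using (Any; here; there)
import Data.List.Relation.Unary.Any.Properties as Any
open import Data.List.Relation.Unary.Unique.Propositional using (Unique)
import Data.List.Relation.Unary.Unique.Propositional.Properties as Unique
open import Data.Nat as ℕ using (ℕ; zero; suc; z≤n; s≤s; _≤_)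
open import Data.Nat.ListAction using (sum)
import Data.Nat.Properties as ℕ
open import Data.Nat.Solver using () renaming (module +-*-Solver to ℕ-Solver)
open import Data.Product using (Σ-syntax; ∃; ∃-syntax; _×_; _,_; proj₁; proj₂)
open import Data.Rational using (ℚ; 0ℚ; 1ℚ; ½; _+_; _-_; _*_; _<_; nonNegative)
  renaming (_≤_ to _≤ℚ_)
import Data.Rational.Properties as ℚ
open import Data.Rational.Solver using (module +-*-Solver)
open import Data.Sum using (_⊎_; inj₁; inj₂; [_,_]′; swap)
open import Function using (_∘_; id; flip)
open import Function.Bundles using (mk⇔; module Equivalence)
open import Induction.WellFounded using (Acc; acc)
open import Level using (0ℓ)
open import Relation.Binary using (Rel; DecTotalOrder; IsStrictPartialOrder)
open import Relation.Binary.Construct.Closure.ReflexiveTransitive as Star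
  using (Star; ε; _◅_; _◅◅_)
import Relation.Binary.Construct.Closure.ReflexiveTransitive.Properties as Star
open import Relation.Binary.PropositionalEquality
  using (_≡_; _≢_; refl; sym; trans; cong; cong₂; subst; subst₂; isEquivalence; module ≡-Reasoning)
open import Relation.Nullary using (¬_; Dec; yes; no; does; contradiction)
open import Relation.Nullary.Decidable
  using (recompute; from-yes; decidable-stable; dec-true; dec-false; does-⇔; _⊎-dec_)
open import Relation.Unary using (Decidable)
open import Data.List.Extrema (DecTotalOrder.totalOrder ℚ.≤-decTotalOrder)
  using (argmin; f[argmin]≤v⁺)
open Equivalence using (to; from)

-- The weights need not turn `T` itself into a shortest path tree. It is enough that all internal
-- vertices of `T` lie close to the root and that every leaf of `T` is entered from an internal
-- vertex. The root must be internal too, which is where `3 ≤ n` enters: a single edge has two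
-- leaves, but from either end only one branch is visible. The powers of two do two jobs: a sum of
-- distinct powers determines its summands, which gives uniqueness, and distinct powers with
-- exponents below `n` sum to less than `2 ^ n`, so one gap in the exponents separates light
-- vertices from heavy ones.

+-cancelˡ-≤ : ∀ r {p q} → r + p ≤ℚ r + q → p ≤ℚ q
+-cancelˡ-≤ r r+p≤r+q = ℚ.≮⇒≥ λ q<p → ℚ.<-irrefl refl (ℚ.<-≤-trans (ℚ.+-monoʳ-< r q<p) r+p≤r+q)

+-cancelˡ-< : ∀ r {p q} → r + p < r + q → p < q
+-cancelˡ-< r r+p<r+q = ℚ.≰⇒> λ q≤p → ℚ.<-irrefl refl (ℚ.<-≤-trans r+p<r+q (ℚ.+-monoʳ-≤ r q≤p))

+-cancelˡ-≡ : ∀ r {p q} → r + p ≡ r + q → p ≡ q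
+-cancelˡ-≡ r = Group.∙-cancelˡ ℚ.+-0-group r _ _

+-cancelʳ-≤ : ∀ r {p q} → p + r ≤ℚ q + r → p ≤ℚ q
+-cancelʳ-≤ r {p} {q} rewrite ℚ.+-comm p r | ℚ.+-comm q r = +-cancelˡ-≤ r

-- Sizes of sets

module _ {a} {A : Set a} where

  unique⇒lookup-injective : ∀ {xs : List A} → Unique xs →
    ∀ {i j} → lookup xs i ≡ lookup xs j → i ≡ j
  unique⇒lookup-injective (_ ∷ _)  {zero}  {zero}  _  = refl
  unique⇒lookup-injective (x≢ ∷ _) {zero}  {suc j} eq =
    contradiction eq (All.lookup x≢ (∈.∈-lookup j))
  unique⇒lookup-injective (x≢ ∷ _) {suc i} {zero}  eq =
    contradiction (sym eq) (All.lookup x≢ (∈.∈-lookup i))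
  unique⇒lookup-injective (_ ∷ u)  {suc i} {suc j} eq =
    cong suc (unique⇒lookup-injective u eq)

  -- Pigeonhole for a relation: a point may have several leaves below it, so one is chosen for each
  -- entry, and its position in `ys` gives an injection of indices.
  length-≤-by : ∀ {b r} {B : Set b} (R : A → B → Set r) {xs ys} → Unique xs →
    (∀ {x} → x ∈ xs → ∃[ y ] (y ∈ ys × R x y)) →
    (∀ {x x′ y} → x ∈ xs → x′ ∈ xs → R x y → R x′ y → x ≡ x′) →
    length xs ℕ.≤ length ys
  length-≤-by {B = B} R {xs} {ys} u tot inj = Fin.injective⇒≤ {f = g} g-inj
    where
    y∈ys : ∀ i → proj₁ (tot (∈.∈-lookup {xs = xs} i)) ∈ ys
    y∈ys i = proj₁ (proj₂ (tot (∈.∈-lookup i)))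

    g : Fin (length xs) → Fin (length ys)
    g i = Any.index (y∈ys i)

    R-g : ∀ i → R (lookup xs i) (lookup ys (g i))
    R-g i = subst (R (lookup xs i)) (Any.lookup-index (y∈ys i))
      (proj₂ (proj₂ (tot (∈.∈-lookup i))))

    g-inj : ∀ {i j} → g i ≡ g j → i ≡ j
    g-inj {i} {j} eq = unique⇒lookup-injective u
      (inj (∈.∈-lookup i) (∈.∈-lookup j) (R-g i)
        (subst (R (lookup xs j) ∘ lookup ys) (sym eq) (R-g j)))

  unique-constant⇒length≤1 : ∀ {xs : List A} → Unique xs →
    (∀ {x y} → x ∈ xs → y ∈ xs → x ≡ y) → length xs ℕ.≤ 1
  unique-constant⇒length≤1 []      _  = z≤n
  unique-constant⇒length≤1 (_ ∷ []) _ = s≤s z≤n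
  unique-constant⇒length≤1 ((x≢y ∷ _) ∷ _ ∷ _) eq =
    contradiction (eq (here refl) (there (here refl))) x≢y

  length≤1⇒constant : ∀ {xs : List A} → length xs ℕ.≤ 1 →
    ∀ {x y} → x ∈ xs → y ∈ xs → x ≡ y
  length≤1⇒constant {_ ∷ []}    _ (here refl) (here refl) = refl
  length≤1⇒constant {_ ∷ _ ∷ _} (s≤s ())

  hasSize-≤ : ∀ {p} {P : A → Set p} {j k} → HasSize P j → HasSize P k → j ℕ.≤ k
  hasSize-≤ (xs , u , xs⇔ , refl) (ys , _ , ys⇔ , refl) =
    length-≤-by _≡_ u (λ x∈ → _ , from (ys⇔ _) (to (xs⇔ _) x∈) , refl)
      (λ { _ _ refl refl → refl })

  -- Meant for the points of a cut, which have no enumeration at hand: the list is pulled back from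
  -- the leaves by choosing preimages, and injectivity on `P` makes it exhaustive.
  hasSize-via : ∀ {b p q} {B : Set b} {P : A → Set p} {Q : B → Set q} {k} (f : A → B) →
    (∀ {x} → P x → Q (f x)) →
    (∀ {x x′} → P x → P x′ → f x ≡ f x′ → x ≡ x′) →
    (∀ {y} → Q y → ∃[ x ] (P x × f x ≡ y)) →
    HasSize Q k → HasSize P k
  hasSize-via {P = P} {Q} f pres inj surj (ys , u , ys⇔ , refl)
    with preimages (All.tabulate (λ {y} y∈ → surj (to (ys⇔ y) y∈)))
    where
    preimages : ∀ {ys} → All (λ y → ∃[ x ] (P x × f x ≡ y)) ys →
      ∃[ xs ] (All P xs × map f xs ≡ ys)
    preimages []                     = [] , [] , refl
    preimages ((x , px , refl) ∷ ps) =
      let xs , pxs , eq = preimages ps in x ∷ xs , px ∷ pxs , cong (f x ∷_) eq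
  ... | xs , pxs , refl =
      xs , Unique.map⁻ u ,
      (λ x → mk⇔ (All.lookup pxs) (λ px →
        let x′ , x′∈ , eq = ∈.∈-map⁻ f (from (ys⇔ (f x)) (pres px))
        in subst (_∈ xs) (sym (inj px (All.lookup pxs x′∈) eq)) x′∈)) ,
      sym (List.length-map f xs)

hasSize-decidable : ∀ {n p} {P : Fin n → Set p} → Decidable P → ∃ (HasSize P)
hasSize-decidable {n} P? = _ , filter P? (allFin n) , Unique.filter⁺ P? (Unique.allFin⁺ n) ,
  (λ x → mk⇔ (proj₂ ∘ ∈.∈-filter⁻ P? {xs = allFin n}) (∈.∈-filter⁺ P? (∈.∈-allFin x))) , refl

unique⇒length≤n : ∀ {n} {xs : List (Fin n)} → Unique xs → length xs ℕ.≤ n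
unique⇒length≤n {n} {xs} u = subst (length xs ℕ.≤_) (List.length-tabulate {n = n} id)
  (length-≤-by _≡_ u (λ {x} _ → x , ∈.∈-allFin x , refl) (λ { _ _ refl refl → refl }))

module _ {n} (G : Graph n) where
  open Graph G

  degree≤1⇒constant : ∀ {v} → Leaf G v → ∀ {x y} → v ~ x → v ~ y → x ≡ y
  degree≤1⇒constant (_ , (xs , _ , xs⇔ , refl) , ≤1) v~x v~y =
    length≤1⇒constant ≤1 (from (xs⇔ _) v~x) (from (xs⇔ _) v~y)

  constant⇒leaf : ∀ {v} → (∀ {x y} → v ~ x → v ~ y → x ≡ y) → Leaf G v
  constant⇒leaf {v} eq with hasSize-decidable (v ~?_)
  ... | d , size@(xs , u , xs⇔ , refl) =
    d , size , unique-constant⇒length≤1 u (λ x∈ y∈ → eq (to (xs⇔ _) x∈) (to (xs⇔ _) y∈))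

  leaf? : Decidable (Leaf G)
  leaf? v with hasSize-decidable (v ~?_)
  ... | d , size with d ℕ.≤? 1
  ...   | yes d≤1 = yes (d , size , d≤1)
  ...   | no  d≰1 = no λ (_ , size′ , d′≤1) → d≰1 (ℕ.≤-trans (hasSize-≤ size size′) d′≤1)

-- Walks

  head∈ : ∀ {u v} (p : Walk G u v) → u ∈ vertices G p
  head∈ ε       = here refl
  head∈ (_ ◅ _) = here refl

  last∈ : ∀ {u v} (p : Walk G u v) → v ∈ vertices G p
  last∈ ε       = here refl
  last∈ (_ ◅ p) = there (last∈ p)

  vertices-◅◅ : ∀ {u x y v} (p : Walk G u x) (e : x ~ y) (q : Walk G y v) →
    vertices G (p ◅◅ e ◅ q) ≡ vertices G p ++ vertices G q
  vertices-◅◅ ε       e q = refl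
  vertices-◅◅ (_ ◅ p) e q = cong (_ ∷_) (vertices-◅◅ p e q)

  vertices≢[] : ∀ {u v} (p : Walk G u v) → vertices G p ≢ []
  vertices≢[] ε       ()
  vertices≢[] (_ ◅ _) ()

  vertices⇒last : ∀ {u v u′ v′} (p : Walk G u v) (q : Walk G u′ v′) →
    vertices G p ≡ vertices G q → v ≡ v′
  vertices⇒last ε       ε       refl = refl
  vertices⇒last ε       (_ ◅ q) eq   = contradiction (sym (List.∷-injectiveʳ eq)) (vertices≢[] q)
  vertices⇒last (_ ◅ p) ε       eq   = contradiction (List.∷-injectiveʳ eq) (vertices≢[] p)
  vertices⇒last (_ ◅ p) (_ ◅ q) eq   = vertices⇒last p q (List.∷-injectiveʳ eq)

  split : ∀ {u v x} (p : Walk G u v) → x ∈ vertices G p →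
    Σ[ q ∈ Walk G u x ] Σ[ r ∈ Walk G x v ] p ≡ q ◅◅ r
  split ε       (here refl) = ε , ε , refl
  split (e ◅ p) (here refl) = ε , e ◅ p , refl
  split (e ◅ p) (there x∈)  = let q , r , eq = split p x∈ in e ◅ q , r , cong (e ◅_) eq

  data LastStep {u} : ∀ {v} → Walk G u v → Set where
    none : LastStep ε
    _▻_  : ∀ {x v} (p : Walk G u x) (e : x ~ v) → LastStep (p ◅◅ e ◅ ε)

  lastStep : ∀ {u v} (p : Walk G u v) → LastStep p
  lastStep ε       = none
  lastStep (e ◅ p) with lastStep p
  ... | none   = ε ▻ e
  ... | q ▻ e′ = (e ◅ q) ▻ e′

  open DecMembership (Fin._≟_ {n}) using (_∈?_)

  weight-tail : ∀ (W : Weights G) {u x v} (e : u ~ x) (p : Walk G x v) →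
    weight W p < weight W (e ◅ p)
  weight-tail W {u} {x} e p = subst (_< Weights.ℓ W u x + weight W p) (ℚ.+-identityˡ _)
    (ℚ.+-monoˡ-< (weight W p) (Weights.ℓ-pos W e))

  simple-suffix : ∀ {u v x} (p : Walk G u v) → Unique (vertices G p) → x ∈ vertices G p →
    Σ[ q ∈ Walk G x v ] (Unique (vertices G q) × ∀ (W : Weights G) → weight W q ≤ℚ weight W p)
  simple-suffix ε       u       (here refl) = ε , u , λ _ → ℚ.≤-refl
  simple-suffix (e ◅ p) u       (here refl) = e ◅ p , u , λ _ → ℚ.≤-refl
  simple-suffix (e ◅ p) (_ ∷ u) (there x∈)  =
    let q , uq , q≤p = simple-suffix p u x∈ in
    q , uq , λ W → ℚ.≤-trans (q≤p W) (ℚ.<⇒≤ (weight-tail W e p))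

  -- Cutting out loops only removes positive weight. The bound quantifies over all weightings so
  -- that the lemma also serves spanning trees, which carry no weights.
  simplify : ∀ {u v} (p : Walk G u v) →
    Σ[ q ∈ Walk G u v ] (Unique (vertices G q) × ∀ (W : Weights G) → weight W q ≤ℚ weight W p)
  simplify ε           = ε , [] ∷ [] , λ _ → ℚ.≤-refl
  simplify {u} (_◅_ {j = x} e p) with simplify p
  ... | q , uq , q≤p with u ∈? vertices G q
  ...   | no u∉ =
    e ◅ q , ¬Any⇒All¬ _ u∉ ∷ uq , λ W → ℚ.+-monoʳ-≤ (Weights.ℓ W u x) (q≤p W)
  ...   | yes u∈ with simple-suffix q uq u∈
  ...     | r , ur , r≤q =
    r , ur , λ W → ℚ.≤-trans (r≤q W) (ℚ.≤-trans (q≤p W) (ℚ.<⇒≤ (weight-tail W e p)))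

  -- Enumeration of walks and existence of shortest walks

  loops : ∀ u v → List (Walk G u v)
  loops u v with u Fin.≟ v
  ... | yes refl = ε ∷ []
  ... | no _     = []

  -- The index bounds the number of vertices, not of edges, so index `n` covers all simple walks.
  walks : ℕ → ∀ u v → List (Walk G u v)
  walks-via : ℕ → ∀ u v → Fin n → List (Walk G u v)

  walks zero    u v = []
  walks (suc k) u v = loops u v ++ concatMap (walks-via k u v) (allFin n)

  walks-via k u v x with u ~? x
  ... | yes e = map (e ◅_) (walks k x v)
  ... | no _  = []

  module _ (W : Weights G) where
    open Weights W

    -- The walk found may use other proofs of adjacency than the given one, so only the
    -- weights are compared.
    walks-complete : ∀ {u v} k (p : Walk G u v) → length (vertices G p) ℕ.≤ k →
      Any (λ q → weight W q ≡ weight W p) (walks k u v)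
    walks-complete {u} (suc k) ε _ with u Fin.≟ u
    ... | yes refl = here refl
    ... | no u≢u   = contradiction refl u≢u
    walks-complete {u} {v} (suc k) (_◅_ {j = x} e p) (s≤s p≤k) =
      Any.++⁺ʳ (loops u v) (Any.concatMap⁺ (walks-via k u v) (Any.map at-x (∈.∈-allFin x)))
      where
      at-x : ∀ {y} → x ≡ y → Any (λ q → weight W q ≡ weight W (e ◅ p)) (walks-via k u v y)
      at-x refl with u ~? x
      ... | yes _  = Any.map⁺ (Any.map (cong (ℓ u x +_)) (walks-complete k p p≤k))
      ... | no u≁x = contradiction e u≁x

    abstract
      -- Infinitely many walks compete, but each is no lighter than a simple one, whose weight
      -- occurs in the finite list `walks n u v`. The given walk is the default of `argmin`.
      shortest-exists : ∀ {u v} → Walk G u v → Σ[ p ∈ Walk G u v ] Shortest W p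
      shortest-exists {u} {v} p₀ = argmin (weight W) p₀ (walks n u v) , λ q →
        let r , ur , r≤q = simplify q in
        ℚ.≤-trans
          (f[argmin]≤v⁺ p₀ (walks n u v)
            (inj₂ (Any.map ℚ.≤-reflexive (walks-complete n r (unique⇒length≤n ur)))))
          (r≤q W)

    weight-◅◅ : ∀ {u x v} (p : Walk G u x) (q : Walk G x v) →
      weight W (p ◅◅ q) ≡ weight W p + weight W q
    weight-◅◅ ε                 q = sym (ℚ.+-identityˡ _)
    weight-◅◅ (_◅_ {u} {x} _ p) q =
      trans (cong (ℓ u x +_) (weight-◅◅ p q)) (sym (ℚ.+-assoc (ℓ u x) _ _))

    weight-▻ : ∀ {u x v} (p : Walk G u x) (e : x ~ v) →
      weight W (p ◅◅ e ◅ ε) ≡ weight W p + ℓ x v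
    weight-▻ {x = x} {v} p e =
      trans (weight-◅◅ p (e ◅ ε)) (cong (weight W p +_) (ℚ.+-identityʳ (ℓ x v)))

    0≤weight : ∀ {u v} (p : Walk G u v) → 0ℚ ≤ℚ weight W p
    0≤weight ε       = ℚ.≤-refl
    0≤weight (e ◅ p) = ℚ.≤-trans (0≤weight p) (ℚ.<⇒≤ (weight-tail W e p))

    shortest-prefix : ∀ {u x v} (p : Walk G u x) (q : Walk G x v) →
      Shortest W (p ◅◅ q) → Shortest W p
    shortest-prefix p q sh p′ = +-cancelʳ-≤ (weight W q) (begin
      weight W p + weight W q   ≡⟨ weight-◅◅ p q ⟨
      weight W (p ◅◅ q)         ≤⟨ sh (p′ ◅◅ q) ⟩
      weight W (p′ ◅◅ q)        ≡⟨ weight-◅◅ p′ q ⟩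
      weight W p′ + weight W q  ∎)
      where open ℚ.≤-Reasoning

    shortest-tail : ∀ {u x v} (e : u ~ x) (p : Walk G x v) → Shortest W (e ◅ p) → Shortest W p
    shortest-tail {u} {x} e p sh p′ = +-cancelˡ-≤ (ℓ u x) (sh (e ◅ p′))

    shortest-weight : ∀ {u v} (p q : Walk G u v) → Shortest W p → Shortest W q →
      weight W p ≡ weight W q
    shortest-weight p q p-sh q-sh = ℚ.≤-antisym (p-sh q) (q-sh p)

    -- If `u` recurred, the part after its return would be a strictly lighter walk.
    shortest⇒simple : ∀ {u v} (p : Walk G u v) → Shortest W p → Unique (vertices G p)
    shortest⇒simple ε       sh = [] ∷ []
    shortest⇒simple {u} (e ◅ p) sh = ¬Any⇒All¬ _ u∉p ∷ shortest⇒simple p (shortest-tail e p sh)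
      where
      u∉p : u ∉ vertices G p
      u∉p u∈p with split p u∈p
      ... | q , r , refl = ℚ.<-irrefl refl (begin-strict
        weight W (e ◅ q ◅◅ r)  ≤⟨ sh r ⟩
        weight W r             ≡⟨ ℚ.+-identityˡ _ ⟨
        0ℚ + weight W r        ≤⟨ ℚ.+-monoˡ-≤ (weight W r) (0≤weight q) ⟩
        weight W q + weight W r  ≡⟨ weight-◅◅ q r ⟨
        weight W (q ◅◅ r)      <⟨ weight-tail W e (q ◅◅ r) ⟩
        weight W (e ◅ q ◅◅ r)  ∎)
        where open ℚ.≤-Reasoning

-- Shortest path trees

-- A cycle in a forest would, read from any of its vertices, first climb to parents and then
-- descend to children, since a step to a child is never followed by one to a parent.
module _ {n} (T : Graph n) (_⇒_ : Rel (Fin n) 0ℓ)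
  (orient : ∀ {u v} → Graph._~_ T u v → u ⇒ v ⊎ v ⇒ u)
  (parent-unique : ∀ {u u′ v} → u ⇒ v → u′ ⇒ v → u ≡ u′)
  (height : Fin n → ℚ)
  (⇒-height : ∀ {u v} → u ⇒ v → height u < height v)
  where

  -- The parent `a` just left is kept in the uniqueness hypothesis: a step up from `x` could only
  -- lead back to it. The last disjunct provides the parent of the end, to be compared with the
  -- closing edge of a cycle.
  simple-descends : ∀ {a x v} → a ⇒ x → (p : Walk T x v) → Unique (a ∷ vertices T p) →
    height x ≤ℚ height v × (x ≡ v ⊎ ∃[ y ] (y ⇒ v × y ∈ vertices T p))
  simple-descends a⇒x ε _ = ℚ.≤-refl , inj₁ refl
  simple-descends a⇒x (e ◅ p) ((_ ∷ a∉p) ∷ u) with orient e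
  ... | inj₂ z⇒x =
    contradiction (subst (_∈ vertices T p) (parent-unique z⇒x a⇒x) (head∈ T p)) (All¬⇒¬Any a∉p)
  ... | inj₁ x⇒z with simple-descends x⇒z p u
  ...   | z≤v , inj₁ refl            = ℚ.<⇒≤ (⇒-height x⇒z) , inj₂ (_ , x⇒z , here refl)
  ...   | z≤v , inj₂ (y , y⇒v , y∈p) =
    ℚ.≤-trans (ℚ.<⇒≤ (⇒-height x⇒z)) z≤v , inj₂ (y , y⇒v , there y∈p)

  simple-climbs⊎descends : ∀ {x v} (p : Walk T x v) → Unique (vertices T p) →
    height v ≤ℚ height x ⊎ ∃[ y ] (y ⇒ v × y ∈ vertices T p)
  simple-climbs⊎descends ε _ = inj₁ ℚ.≤-refl
  simple-climbs⊎descends (e ◅ p) u@(_ ∷ u′) with orient e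
  ... | inj₁ x⇒z with simple-descends x⇒z p u
  ...   | _ , inj₁ refl            = inj₂ (_ , x⇒z , here refl)
  ...   | _ , inj₂ (y , y⇒v , y∈p) = inj₂ (y , y⇒v , there y∈p)
  simple-climbs⊎descends (e ◅ p) (_ ∷ u′) | inj₂ z⇒x with simple-climbs⊎descends p u′
  ...   | inj₁ v≤z             = inj₁ (ℚ.≤-trans v≤z (ℚ.<⇒≤ (⇒-height z⇒x)))
  ...   | inj₂ (y , y⇒v , y∈p) = inj₂ (y , y⇒v , there y∈p)

  -- Orienting the first step and the closing edge gives the cases. Each ends with heights
  -- increasing around the cycle, or with two parents of one vertex that simplicity keeps distinct,
  -- or with a walk that returns to its start.
  forest⇒acyclic : ¬ Cyclic T
  forest⇒acyclic (u , v , ε , _ , s≤s () , _)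
  forest⇒acyclic (u , v , _ ◅ ε , _ , s≤s (s≤s ()) , _)
  forest⇒acyclic (u , v , e ◅ e′ ◅ p , uniq@(u∉ ∷ x∉p ∷ _) , _ , v~u) with orient e | orient v~u
  ... | inj₂ x⇒u | inj₁ v⇒u =
    contradiction (subst (_∈ vertices T p) (parent-unique v⇒u x⇒u) (last∈ T p)) (All¬⇒¬Any x∉p)
  ... | inj₁ u⇒x | closing with simple-descends u⇒x (e′ ◅ p) uniq | closing
  ...   | _ , inj₁ refl | _ = contradiction (last∈ T p) (All¬⇒¬Any x∉p)
  ...   | x≤v , _ | inj₁ v⇒u =
    ℚ.<-irrefl refl (ℚ.<-≤-trans (ℚ.<-trans (⇒-height v⇒u) (⇒-height u⇒x)) x≤v)
  ...   | _ , inj₂ (y , y⇒v , y∈) | inj₂ u⇒v =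
    contradiction (subst (_∈ _) (parent-unique y⇒v u⇒v) y∈) (All¬⇒¬Any u∉)
  forest⇒acyclic (u , v , e ◅ e′ ◅ p , (u∉ ∷ uniq) , _ , v~u) | inj₂ x⇒u | inj₂ u⇒v
    with simple-climbs⊎descends (e′ ◅ p) uniq
  ... | inj₁ v≤x =
    ℚ.<-irrefl refl (ℚ.≤-<-trans v≤x (ℚ.<-trans (⇒-height x⇒u) (⇒-height u⇒v)))
  ... | inj₂ (y , y⇒v , y∈) =
    contradiction (subst (_∈ _) (parent-unique y⇒v u⇒v) y∈) (All¬⇒¬Any u∉)

module ShortestPathTree {n} {G : Graph n} (connected : Connected G) (W : Weights G)
  (unique-paths : UniqueShortestPaths W) (s : Fin n) where
  open Graph G
  open Weights W

  dist : Fin n → ℚ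
  dist v = weight W (proj₁ (shortest-exists G W (connected s v)))

  shortest⇒dist : ∀ {v} (p : Walk G s v) → Shortest W p → weight W p ≡ dist v
  shortest⇒dist {v} p sh =
    let q , q-sh = shortest-exists G W (connected s v) in shortest-weight G W p q sh q-sh

  dist≤weight : ∀ {v} (p : Walk G s v) → dist v ≤ℚ weight W p
  dist≤weight {v} p = proj₂ (shortest-exists G W (connected s v)) p

  dist-root : dist s ≡ 0ℚ
  dist-root = sym (shortest⇒dist ε (0≤weight G W))

  arc-dist : ∀ {u v} → Arc W s u v → dist v ≡ dist u + ℓ u v
  arc-dist {u} {v} (p , e , sh) = begin
    dist v                    ≡⟨ shortest⇒dist (p ◅◅ e ◅ ε) sh ⟨
    weight W (p ◅◅ e ◅ ε)     ≡⟨ weight-▻ G W p e ⟩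
    weight W p + ℓ u v        ≡⟨ cong (_+ ℓ u v)
                                   (shortest⇒dist p (shortest-prefix G W p (e ◅ ε) sh)) ⟩
    dist u + ℓ u v            ∎
    where open ≡-Reasoning

  dist-edge : ∀ {u v} → u ~ v → dist v ≤ℚ dist u + ℓ u v
  dist-edge {u} {v} e =
    let p = proj₁ (shortest-exists G W (connected s u)) in
    ℚ.≤-trans (dist≤weight (p ◅◅ e ◅ ε)) (ℚ.≤-reflexive (weight-▻ G W p e))

  arc-edge : ∀ {u v} → Arc W s u v → u ~ v
  arc-edge (_ , e , _) = e

  arc-dist-< : ∀ {u v} → Arc W s u v → dist u < dist v
  arc-dist-< {u} {v} a = begin-strict
    dist u          ≡⟨ ℚ.+-identityʳ (dist u) ⟨
    dist u + 0ℚ     <⟨ ℚ.+-monoʳ-< (dist u) (ℓ-pos (arc-edge a)) ⟩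
    dist u + ℓ u v  ≡⟨ arc-dist a ⟨
    dist v          ∎
    where open ℚ.≤-Reasoning

  -- Both arcs complete shortest walks from `s` to `v`, whose vertex lists agree by `unique-paths`,
  -- hence also in the last entry but one.
  arc-unique : ∀ {u u′ v} → Arc W s u v → Arc W s u′ v → u ≡ u′
  arc-unique (p , e , sh) (p′ , e′ , sh′) = vertices⇒last G p p′
    (List.∷ʳ-injectiveˡ _ _ (begin
      vertices G p ∷ʳ _             ≡⟨ vertices-◅◅ G p e ε ⟨
      vertices G (p ◅◅ e ◅ ε)       ≡⟨ unique-paths _ _ sh sh′ ⟩
      vertices G (p′ ◅◅ e′ ◅ ε)     ≡⟨ vertices-◅◅ G p′ e′ ε ⟩
      vertices G p′ ∷ʳ _            ∎))
    where open ≡-Reasoning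

  0≤dist : ∀ v → 0ℚ ≤ℚ dist v
  0≤dist v = 0≤weight G W (proj₁ (shortest-exists G W (connected s v)))

  no-arc-into-root : ∀ {u} → ¬ Arc W s u s
  no-arc-into-root {u} a = ℚ.<-irrefl refl
    (ℚ.≤-<-trans (0≤dist u) (subst (dist u <_) dist-root (arc-dist-< a)))

  -- `Arc` quantifies over all walks, but by `arc-unique` the last step of a single shortest walk
  -- decides it.
  arc? : ∀ u v → Dec (Arc W s u v)
  arc? u v with shortest-exists G W (connected s v)
  ... | p , sh with lastStep G p
  ...   | none   = no λ a → no-arc-into-root a
  ...   | _▻_ {x} q e with u Fin.≟ x
  ...     | yes refl = yes (q , e , sh)
  ...     | no u≢    = no λ a → u≢ (arc-unique a (q , e , sh))

  -- Ancestors and leaves in the shortest path tree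

  Ancestor : Rel (Fin n) _
  Ancestor = Star (Arc W s)

  shortest⇒ancestor : ∀ {u v} (p : Walk G s u) (q : Walk G u v) → Shortest W (p ◅◅ q) → Ancestor u v
  shortest⇒ancestor p ε       sh = ε
  shortest⇒ancestor p (e ◅ q) sh =
    (p , e , shortest-prefix G W (p ◅◅ e ◅ ε) q sh′) ◅ shortest⇒ancestor (p ◅◅ e ◅ ε) q sh′
    where
    sh′ : Shortest W ((p ◅◅ e ◅ ε) ◅◅ q)
    sh′ = subst (Shortest W) (sym (Star.◅◅-assoc p (e ◅ ε) q)) sh

  root-ancestor : ∀ v → Ancestor s v
  root-ancestor v =
    let p , sh = shortest-exists G W (connected s v) in shortest⇒ancestor ε p sh

  ancestor-dist : ∀ {u v} → Ancestor u v → dist u ≤ℚ dist v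
  ancestor-dist ε       = ℚ.≤-refl
  ancestor-dist (a ◅ p) = ℚ.≤-trans (ℚ.<⇒≤ (arc-dist-< a)) (ancestor-dist p)

  ancestor-last : ∀ {u w} → Ancestor u w → u ≡ w ⊎ ∃[ y ] (Ancestor u y × Arc W s y w)
  ancestor-last ε       = inj₁ refl
  ancestor-last (a ◅ p) with ancestor-last p
  ... | inj₁ refl          = inj₂ (_ , ε , a)
  ... | inj₂ (y , x⇝y , b) = inj₂ (y , a ◅ x⇝y , b)

  tree : Graph n
  tree = record
    { _~_   = λ u v → Arc W s u v ⊎ Arc W s v u
    ; ~-sym = swap
    ; ~-irr = λ { refl → [ ~-irr refl ∘ arc-edge , ~-irr refl ∘ arc-edge ]′ }
    ; _~?_  = λ u v → arc? u v ⊎-dec arc? v u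
    }

  tree-spanning : IsSpanningTree G tree
  tree-spanning =
    [ arc-edge , ~-sym ∘ arc-edge ]′ ,
    (λ u v → Star.reverse swap (from-root u) ◅◅ from-root v) ,
    forest⇒acyclic tree (Arc W s) id arc-unique dist arc-dist-<
    where
    from-root : ∀ v → Walk tree s v
    from-root v = Star.map inj₁ (root-ancestor v)

  childless⇒leaf : ∀ {w} → (∀ x → ¬ Arc W s w x) → Leaf tree w
  childless⇒leaf no-child = constant⇒leaf tree λ
    { (inj₁ a) _        → contradiction a (no-child _)
    ; (inj₂ _) (inj₁ b) → contradiction b (no-child _)
    ; (inj₂ a) (inj₂ b) → arc-unique a b
    }

  -- Moving to a child strictly increases `dist`, which cannot go on forever among finitely many
  -- vertices.
  leaf-below : ∀ u → ∃[ w ] (Ancestor u w × Leaf tree w)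
  leaf-below u = go u (spo-noetherian dist-order u)
    where
    dist-order : IsStrictPartialOrder _≡_ (λ u v → dist u < dist v)
    dist-order = record
      { isEquivalence = isEquivalence
      ; irrefl        = λ { refl → ℚ.<-irrefl refl }
      ; trans         = ℚ.<-trans
      ; <-resp-≈      = (λ { refl → id }) , (λ { refl → id })
      }

    go : ∀ u → Acc (λ u v → dist v < dist u) u → ∃[ w ] (Ancestor u w × Leaf tree w)
    go u (acc rec) with Fin.any? (arc? u)
    ... | yes (x , a)  = let w , x⇝w , leaf = go x (rec (arc-dist-< a)) in w , a ◅ x⇝w , leaf
    ... | no ¬child    = u , ε , childless⇒leaf (λ x a → ¬child (x , a))

  -- Read upwards from `w`, both paths follow the same unique parents until the shorter one stops.
  ancestors-comparable : ∀ {u u′ w} → Ancestor u w → Ancestor u′ w → Ancestor u u′ ⊎ Ancestor u′ u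
  ancestors-comparable u⇝w u′⇝w = go (Star.reverse id u⇝w) (Star.reverse id u′⇝w)
    where
    go : ∀ {u u′ w} → Star (flip (Arc W s)) w u → Star (flip (Arc W s)) w u′ →
      Ancestor u u′ ⊎ Ancestor u′ u
    go ε       q       = inj₂ (Star.reverse id q)
    go p       ε       = inj₁ (Star.reverse id p)
    go (a ◅ p) (b ◅ q) with refl ← arc-unique a b = go p q

  -- The lower end of the segment that carries a point determines the point, given its
  -- distance from the root.
  bottom : Point W s → Fin n
  bottom (node v)            = v
  bottom (inner _ v _ _ _ _) = v

  height : Point W s → ℚ
  height (node v)            = dist v
  height (inner u _ α _ _ _) = dist u + α

  onSegment-height : ∀ {u v y α} → Arc W s u v → OnSegment W s u v y α → height y ≡ dist u + α
  onSegment-height _ start  = sym (ℚ.+-identityʳ _)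
  onSegment-height _ inside = refl
  onSegment-height a end    = arc-dist a

  -- The steps of a descent telescope, so its length is a difference of heights and later arguments
  -- are pure arithmetic.
  descent-height : ∀ {x y d} → Descent W s x y d → height y ≡ height x + d
  descent-height stay = sym (ℚ.+-identityʳ _)
  descent-height {x} {z} (move {y} {d = d} {u} {v} {α} {β} x⇝y a y∈ z∈ _) = begin
    height z                      ≡⟨ onSegment-height a z∈ ⟩
    dist u + β                    ≡⟨ solve 3 (λ u α β → u :+ β := (u :+ α) :+ (β :- α)) refl
                                       (dist u) α β ⟩
    (dist u + α) + (β - α)        ≡⟨ cong (_+ (β - α)) (onSegment-height a y∈) ⟨
    height y + (β - α)            ≡⟨ cong (_+ (β - α)) (descent-height x⇝y) ⟩
    (height x + d) + (β - α)      ≡⟨ ℚ.+-assoc (height x) d (β - α) ⟩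
    height x + (d + (β - α))      ∎
    where
    open ≡-Reasoning
    open +-*-Solver

  root-descent-height : ∀ {x r} → Descent W s (node s) x r → height x ≡ r
  root-descent-height {x} {r} d =
    trans (descent-height d) (trans (cong (_+ r) dist-root) (ℚ.+-identityˡ r))

  ancestor⇒descent : ∀ {x u v d} → Descent W s x (node u) d → Ancestor u v →
    ∃[ d′ ] Descent W s x (node v) d′
  ancestor⇒descent x⇝u ε       = _ , x⇝u
  ancestor⇒descent x⇝u (a ◅ p) =
    ancestor⇒descent (move x⇝u a start end (ℚ.<⇒≤ (ℓ-pos (arc-edge a)))) p

  parent<inner : ∀ u {α} → 0ℚ < α → dist u < dist u + α
  parent<inner u {α} 0<α =
    subst (_< dist u + α) (ℚ.+-identityʳ (dist u)) (ℚ.+-monoʳ-< (dist u) 0<α)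

  -- The proofs inside a point are irrelevant; `recompute` recovers them because `Arc` and the order
  -- on the rationals are decidable.
  inner<bottom : ∀ {u v α} .(a : Arc W s u v) → .(α < ℓ u v) → dist u + α < dist v
  inner<bottom {u} {v} {α} a α<ℓ =
    subst (dist u + α <_) (sym (arc-dist (recompute (arc? u v) a)))
      (ℚ.+-monoʳ-< (dist u) (recompute (_ ℚ.<? _) α<ℓ))

  height≤bottom : ∀ x → height x ≤ℚ dist (bottom x)
  height≤bottom (node _)                = ℚ.≤-refl
  height≤bottom (inner u v α a 0<α α<ℓ) = ℚ.<⇒≤ (inner<bottom a α<ℓ)

  arc-bottom⇒<height : ∀ x {y} → Arc W s y (bottom x) → dist y < height x
  arc-bottom⇒<height (node _)                a = arc-dist-< a
  arc-bottom⇒<height (inner u v α b 0<α α<ℓ) a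
    with refl ← arc-unique a (recompute (arc? u v) b) = parent<inner u (recompute (_ ℚ.<? _) 0<α)

  -- `arc-unique` fixes the upper end of the segment and the height fixes the offset; the other
  -- fields are irrelevant. A node is never confused with an inner point, which lies strictly above
  -- its lower end.
  point-ext : ∀ x x′ → height x ≡ height x′ → bottom x ≡ bottom x′ → x ≡ x′
  point-ext (node v) (node v) _ refl = refl
  point-ext (node v) (inner u v α a 0<α α<ℓ) eq refl =
    contradiction (sym eq) (ℚ.<⇒≢ (inner<bottom a α<ℓ))
  point-ext (inner u v α a 0<α α<ℓ) (node v) eq refl =
    contradiction eq (ℚ.<⇒≢ (inner<bottom a α<ℓ))
  point-ext (inner u v α a _ _) (inner u′ v α′ a′ _ _) eq refl
    with refl ← arc-unique (recompute (arc? u v) a) (recompute (arc? u′ v) a′)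
    with refl ← +-cancelˡ-≡ (dist u) eq = refl

  -- Otherwise `bottom x` is an ancestor of the parent of `bottom x′`, and that parent is strictly
  -- closer to the root than `x′`.
  ancestor-bottom⇒≡ : ∀ x x′ → height x ≡ height x′ → Ancestor (bottom x) (bottom x′) →
    bottom x ≡ bottom x′
  ancestor-bottom⇒≡ x x′ eq x⇝x′ with ancestor-last x⇝x′
  ... | inj₁ eq′            = eq′
  ... | inj₂ (y , x⇝y , a) = contradiction (begin-strict
    height x          ≤⟨ height≤bottom x ⟩
    dist (bottom x)   ≤⟨ ancestor-dist x⇝y ⟩
    dist y            <⟨ arc-bottom⇒<height x′ a ⟩
    height x′         ≡⟨ eq ⟨
    height x          ∎) (ℚ.<-irrefl refl)
    where open ℚ.≤-Reasoning

  level-≤-leaves : ∀ {xs k r} → Unique xs → (∀ {x} → x ∈ xs → height x ≡ r) →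
    HasSize (Leaf tree) k → length xs ℕ.≤ k
  level-≤-leaves uniq level (ws , _ , ws⇔ , refl) =
    length-≤-by (λ x w → Ancestor (bottom x) w) uniq
      (λ {x} _ → let w , x⇝w , leaf = leaf-below (bottom x) in w , from (ws⇔ w) leaf , x⇝w)
      λ {x} {x′} x∈ x′∈ x⇝w x′⇝w →
        let eq = trans (level x∈) (sym (level x′∈)) in
        point-ext x x′ eq
          ([ ancestor-bottom⇒≡ x x′ eq , sym ∘ ancestor-bottom⇒≡ x′ x (sym eq) ]′
            (ancestors-comparable x⇝w x′⇝w))

  cut-≤-maxLeafNumber : ∀ {r k ml} → IsMaxLeafNumber G ml → HasSize (Cut W s r) k → k ℕ.≤ ml
  cut-≤-maxLeafNumber (_ , ml-max) (xs , uniq , xs⇔ , refl) =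
    let k , leaves = hasSize-decidable (leaf? tree) in
    ℕ.≤-trans
      (level-≤-leaves uniq (λ x∈ → root-descent-height (proj₂ (to (xs⇔ _) x∈))) leaves)
      (ml-max tree k tree-spanning leaves)

-- Sums of distinct powers of two

bit : Bool → ℕ
bit true  = 1
bit false = 0

binary : ℕ → (ℕ → Bool) → ℕ
binary zero    b = 0
binary (suc N) b = bit (b 0) ℕ.+ 2 ℕ.* binary N (b ∘ suc)

binary-cong : ∀ N {b c} → (∀ i → b i ≡ c i) → binary N b ≡ binary N c
binary-cong zero    eq = refl
binary-cong (suc N) eq rewrite eq 0 | binary-cong N (eq ∘ suc) = refl

binary-false : ∀ N → binary N (λ _ → false) ≡ 0
binary-false zero    = refl
binary-false (suc N) rewrite binary-false N = refl

-- Parity determines digit 0, and halving leaves the remaining digits.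
binary-injective : ∀ N {b c} → binary N b ≡ binary N c → ∀ {i} → i ℕ.< N → b i ≡ c i
binary-injective (suc N) {b} {c} eq {i} i<N with b 0 in b₀ | c 0 in c₀ | i
... | true  | false | _     =
  contradiction (sym eq) (ℕ.even≢odd (binary N (c ∘ suc)) (binary N (b ∘ suc)))
... | false | true  | _     =
  contradiction eq (ℕ.even≢odd (binary N (b ∘ suc)) (binary N (c ∘ suc)))
... | true  | true  | zero  = trans b₀ (sym c₀)
... | false | false | zero  = trans b₀ (sym c₀)
... | true  | true  | suc _ =
  binary-injective N (ℕ.*-cancelˡ-≡ _ _ 2 (ℕ.suc-injective eq)) (ℕ.s<s⁻¹ i<N)
... | false | false | suc _ =
  binary-injective N (ℕ.*-cancelˡ-≡ _ _ 2 eq) (ℕ.s<s⁻¹ i<N)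

binary<2^N : ∀ N b → binary N b ℕ.< 2 ℕ.^ N
binary<2^N zero    b = s≤s z≤n
binary<2^N (suc N) b = begin-strict
  binary (suc N) b                  ≤⟨ digit≤1 ⟩
  1 ℕ.+ 2 ℕ.* binary N (b ∘ suc)    <⟨ ℕ.≤-reflexive (sym (ℕ.*-suc 2 _)) ⟩
  2 ℕ.* suc (binary N (b ∘ suc))    ≤⟨ ℕ.*-monoʳ-≤ 2 (binary<2^N N (b ∘ suc)) ⟩
  2 ℕ.* 2 ℕ.^ N                     ∎
  where
  open ℕ.≤-Reasoning
  digit≤1 : binary (suc N) b ℕ.≤ 1 ℕ.+ 2 ℕ.* binary N (b ∘ suc)
  digit≤1 with b 0
  ... | true  = ℕ.≤-refl
  ... | false = ℕ.n≤1+n _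

binary-insert : ∀ N {b c x} → x ℕ.< N → b x ≡ false → c x ≡ true →
  (∀ {i} → i ≢ x → c i ≡ b i) → binary N c ≡ 2 ℕ.^ x ℕ.+ binary N b
binary-insert (suc N) {b} {c} {zero} _ b₀ c₀ rest
  rewrite b₀ | c₀ | binary-cong N {c ∘ suc} {b ∘ suc} (λ i → rest λ ()) = refl
binary-insert (suc N) {b} {c} {suc x} (s≤s x<N) bx cx rest
  rewrite rest {0} (λ ())
        | binary-insert N {b ∘ suc} {c ∘ suc} x<N bx cx (λ i≢x → rest (i≢x ∘ ℕ.suc-injective)) =
  solve 3 (λ d p m → d :+ con 2 :* (p :+ m) := con 2 :* p :+ (d :+ con 2 :* m)) refl
    (bit (b 0)) (2 ℕ.^ x) (binary N (b ∘ suc))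
  where open ℕ-Solver

powers : List ℕ → ℕ
powers xs = sum (map (2 ℕ.^_) xs)

open DecMembership ℕ._≟_ using () renaming (_∈?_ to _∈ℕ?_)

-- Adding a fresh exponent flips one digit from 0 to 1 without a carry, so the digits are the
-- membership test of the list.
powers≡binary : ∀ {N xs} → Unique xs → All (ℕ._< N) xs →
  powers xs ≡ binary N (λ i → does (i ∈ℕ? xs))
powers≡binary {N} [] [] = sym (binary-false N)
powers≡binary {N} {x ∷ xs} (x∉ ∷ u) (x<N ∷ xs<N) =
  trans (cong (2 ℕ.^ x ℕ.+_) (powers≡binary u xs<N))
    (sym (binary-insert N x<N (dec-false (x ∈ℕ? xs) (All¬⇒¬Any x∉))
      (dec-true (x ∈ℕ? (x ∷ xs)) (here refl))
      λ {i} i≢x → does-⇔ (mk⇔ (λ { (here eq) → contradiction eq i≢x ; (there i∈) → i∈ }) there)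
        (i ∈ℕ? (x ∷ xs)) (i ∈ℕ? xs)))

powers-< : ∀ {N xs} → Unique xs → All (ℕ._< N) xs → powers xs ℕ.< 2 ℕ.^ N
powers-< {N} u <N = subst (ℕ._< 2 ℕ.^ N) (sym (powers≡binary u <N)) (binary<2^N N _)

powers-injective : ∀ {N xs ys} → Unique xs → Unique ys → All (ℕ._< N) xs → All (ℕ._< N) ys →
  powers xs ≡ powers ys → ∀ {x} → x ∈ xs → x ∈ ys
powers-injective {N} {xs} {ys} uxs uys xs<N ys<N eq {x} x∈ with x ∈ℕ? ys in x∈?ys
... | yes x∈ys = x∈ys
... | no _     = contradiction
  (trans (sym (dec-true (x ∈ℕ? xs) x∈))
    (trans (binary-injective N
      (trans (sym (powers≡binary uxs xs<N)) (trans eq (powers≡binary uys ys<N)))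
      (All.lookup xs<N x∈)) (cong does x∈?ys)))
  λ ()

-- Edge weights that are sums of vertex weights

ι : ℕ → ℚ
ι zero    = 0ℚ
ι (suc m) = 1ℚ + ι m

ι-+ : ∀ m k → ι (m ℕ.+ k) ≡ ι m + ι k
ι-+ zero    k = sym (ℚ.+-identityˡ (ι k))
ι-+ (suc m) k = trans (cong (1ℚ +_) (ι-+ m k)) (sym (ℚ.+-assoc 1ℚ (ι m) (ι k)))

ι-<-suc : ∀ m → ι m < ι (suc m)
ι-<-suc m = subst (_< 1ℚ + ι m) (ℚ.+-identityˡ (ι m)) (ℚ.+-monoˡ-< (ι m) (ℚ.positive⁻¹ 1ℚ))

ι-mono-≤ : ∀ {m k} → m ℕ.≤ k → ι m ≤ℚ ι k
ι-mono-≤ {k = zero}  z≤n       = ℚ.≤-refl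
ι-mono-≤ {k = suc k} z≤n       = ℚ.≤-trans (ι-mono-≤ {k = k} z≤n) (ℚ.<⇒≤ (ι-<-suc k))
ι-mono-≤             (s≤s m≤k) = ℚ.+-monoʳ-≤ 1ℚ (ι-mono-≤ m≤k)

ι-mono-< : ∀ {m k} → m ℕ.< k → ι m < ι k
ι-mono-< {m} m<k = ℚ.<-≤-trans (ι-<-suc m) (ι-mono-≤ m<k)

ι-cancel-≤ : ∀ {m k} → ι m ≤ℚ ι k → m ℕ.≤ k
ι-cancel-≤ ιm≤ιk = ℕ.≮⇒≥ λ k<m → ℚ.<-irrefl refl (ℚ.<-≤-trans (ι-mono-< k<m) ιm≤ιk)

module VertexWeights {n} (G : Graph n) (g : Fin n → ℕ) (g-pos : ∀ x → 0 ℕ.< g x) where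
  open Graph G

  W : Weights G
  W = record
    { ℓ     = λ u v → ι (g u ℕ.+ g v)
    ; ℓ-sym = λ {u} {v} _ → cong ι (ℕ.+-comm (g u) (g v))
    ; ℓ-pos = λ {u} {v} _ → ι-mono-< (ℕ.<-≤-trans (g-pos u) (ℕ.m≤m+n (g u) (g v)))
    }

  cost : ∀ {u v} → Walk G u v → ℕ
  cost ε                 = 0
  cost (_◅_ {u} {x} _ p) = g u ℕ.+ g x ℕ.+ cost p

  weight≡cost : ∀ {u v} (p : Walk G u v) → weight W p ≡ ι (cost p)
  weight≡cost ε                 = refl
  weight≡cost (_◅_ {u} {x} _ p) = trans (cong (ι (g u ℕ.+ g x) +_) (weight≡cost p))
    (sym (ι-+ (g u ℕ.+ g x) (cost p)))

  shortest⇒cost-≤ : ∀ {u v} (p q : Walk G u v) → Shortest W p → cost p ℕ.≤ cost q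
  shortest⇒cost-≤ p q sh = ι-cancel-≤ (subst₂ _≤ℚ_ (weight≡cost p) (weight≡cost q) (sh q))

  total : List (Fin n) → ℕ
  total xs = sum (map g xs)

  -- Every inner vertex of a walk is charged by two edges and each end by one. Hence between fixed
  -- ends, comparing costs is comparing totals.
  cost+ends : ∀ {u v} (p : Walk G u v) →
    cost p ℕ.+ (g u ℕ.+ g v) ≡ total (vertices G p) ℕ.+ total (vertices G p)
  cost+ends {u} ε = cong₂ ℕ._+_ (sym (ℕ.+-identityʳ (g u))) (sym (ℕ.+-identityʳ (g u)))
  cost+ends {u} {v} (_◅_ {j = x} _ p) = begin
    g u ℕ.+ g x ℕ.+ cost p ℕ.+ (g u ℕ.+ g v)
      ≡⟨ solve 4 (λ a b c d → a :+ b :+ c :+ (a :+ d) := a :+ a :+ (c :+ (b :+ d))) refl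
           (g u) (g x) (cost p) (g v) ⟩
    g u ℕ.+ g u ℕ.+ (cost p ℕ.+ (g x ℕ.+ g v))
      ≡⟨ cong (g u ℕ.+ g u ℕ.+_) (cost+ends p) ⟩
    g u ℕ.+ g u ℕ.+ (t ℕ.+ t)
      ≡⟨ solve 2 (λ a t → a :+ a :+ (t :+ t) := a :+ t :+ (a :+ t)) refl (g u) t ⟩
    g u ℕ.+ t ℕ.+ (g u ℕ.+ t)  ∎
    where
    open ≡-Reasoning
    open ℕ-Solver
    t = total (vertices G p)

  -- Mutual induction with `detour-cost`: a walk pays for both of its ends, and any vertex in
  -- between adds a positive amount.
  ends≤cost : ∀ {u v} (p : Walk G u v) → u ≢ v → g u ℕ.+ g v ℕ.≤ cost p
  detour-cost : ∀ {u x v} (e : u ~ x) (p : Walk G x v) → x ≢ v → g u ℕ.+ g v ℕ.< cost (e ◅ p)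

  ends≤cost ε u≢u = contradiction refl u≢u
  ends≤cost {u} {v} (_◅_ {j = x} e p) _ with x Fin.≟ v
  ... | yes refl = ℕ.m≤m+n (g u ℕ.+ g x) (cost p)
  ... | no x≢v   = ℕ.<⇒≤ (detour-cost e p x≢v)

  detour-cost {u} {x} {v} e p x≢v = begin-strict
    g u ℕ.+ g v                  <⟨ ℕ.+-monoʳ-< (g u) (ℕ.m<n+m (g v) (g-pos x)) ⟩
    g u ℕ.+ (g x ℕ.+ g v)        ≤⟨ ℕ.+-mono-≤ (ℕ.m≤m+n (g u) (g x)) (ends≤cost p x≢v) ⟩
    g u ℕ.+ g x ℕ.+ cost p       ∎
    where open ℕ.≤-Reasoning

  metric : IsMetric W
  metric e = e ◅ ε ,
    (λ q → subst₂ _≤ℚ_ (sym (ℚ.+-identityʳ _)) (sym (weight≡cost q))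
      (ι-mono-≤ (ends≤cost q λ u≡v → ~-irr u≡v e))) ,
    ℚ.+-identityʳ _

  -- Shortest walks between the same ends have the same total, hence the same vertices, and no
  -- shortest walk takes a detour between adjacent vertices.
  unique-shortest-paths :
    (∀ {xs ys} → Unique xs → Unique ys → total xs ≡ total ys → ∀ {x} → x ∈ xs → x ∈ ys) →
    UniqueShortestPaths W
  unique-shortest-paths total-injective = go
    where
    not-loop : ∀ {u x} (e : u ~ x) (p : Walk G x u) → ¬ Shortest W (e ◅ p)
    not-loop e p sh = ℚ.<-irrefl refl
      (ℚ.<-≤-trans (ℚ.≤-<-trans (0≤weight G W p) (weight-tail G W e p)) (sh ε))

    same-total : ∀ {u v} (p q : Walk G u v) → Shortest W p → Shortest W q →
      total (vertices G p) ≡ total (vertices G q)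
    same-total {u} {v} p q p-sh q-sh = ℕ.*-cancelˡ-≡ _ _ 2 (begin
      2 ℕ.* total (vertices G p)                        ≡⟨ double (total (vertices G p)) ⟩
      total (vertices G p) ℕ.+ total (vertices G p)     ≡⟨ cost+ends p ⟨
      cost p ℕ.+ (g u ℕ.+ g v)                          ≡⟨ cong (ℕ._+ _) (ℕ.≤-antisym
                                                             (shortest⇒cost-≤ p q p-sh)
                                                             (shortest⇒cost-≤ q p q-sh)) ⟩
      cost q ℕ.+ (g u ℕ.+ g v)                          ≡⟨ cost+ends q ⟩
      total (vertices G q) ℕ.+ total (vertices G q)     ≡⟨ double (total (vertices G q)) ⟨
      2 ℕ.* total (vertices G q)                        ∎)
      where
      open ≡-Reasoning
      double : ∀ m → 2 ℕ.* m ≡ m ℕ.+ m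
      double m = cong (m ℕ.+_) (ℕ.+-identityʳ m)

    same-start : ∀ {u x y v} (e : u ~ x) (p : Walk G x v) (f : u ~ y) (q : Walk G y v) →
      Shortest W (e ◅ p) → Shortest W (f ◅ q) → x ≡ y
    same-start {x = x} {y} e p f q ep-sh fq-sh
      with total-injective (shortest⇒simple G W (e ◅ p) ep-sh) (shortest⇒simple G W (f ◅ q) fq-sh)
             (same-total (e ◅ p) (f ◅ q) ep-sh fq-sh) (there (head∈ G p))
    ... | here x≡u = contradiction e (~-irr (sym x≡u))
    ... | there x∈q with split G q x∈q
    ...   | q₁ , q₂ , refl with y Fin.≟ x
    ...     | yes y≡x = sym y≡x
    -- The second walk would reach `x` by way of `y`, although the edge `e` leads there at a lower
    -- cost.
    ...     | no y≢x = contradiction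
      (ℕ.<-≤-trans (detour-cost f q₁ y≢x)
        (shortest⇒cost-≤ (f ◅ q₁) (e ◅ ε) (shortest-prefix G W (f ◅ q₁) q₂ fq-sh)))
      (ℕ.≤⇒≯ (ℕ.≤-reflexive (ℕ.+-identityʳ _)))

    go : UniqueShortestPaths W
    go ε       ε       _     _     = refl
    go ε       (f ◅ q) _     fq-sh = contradiction fq-sh (not-loop f q)
    go (e ◅ p) ε       ep-sh _     = contradiction ep-sh (not-loop e p)
    go (e ◅ p) (f ◅ q) ep-sh fq-sh with refl ← same-start e p f q ep-sh fq-sh =
      cong (_ ∷_) (go p q (shortest-tail G W e p ep-sh) (shortest-tail G W f q fq-sh))

-- Internal vertices of a connected graph

module _ {n} (T : Graph n) where
  open Graph T

  distinct-neighbours⇒¬leaf : ∀ {v x y} → v ~ x → v ~ y → x ≢ y → ¬ Leaf T v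
  distinct-neighbours⇒¬leaf v~x v~y x≢y leaf = x≢y (degree≤1⇒constant T leaf v~x v~y)

  -- An inner vertex of a simple walk has two distinct neighbours, its predecessor and its
  -- successor; `go` carries the edge from the predecessor along.
  simple⇒internal : ∀ {u v} (p : Walk T u v) → Unique (vertices T p) → ¬ Leaf T u →
    All (λ y → y ≡ v ⊎ ¬ Leaf T y) (vertices T p)
  simple⇒internal ε       _       _  = inj₁ refl ∷ []
  simple⇒internal {v = v} (e ◅ p) (u∉ ∷ uniq) u-internal = inj₂ u-internal ∷ go e p u∉ uniq
    where
    go : ∀ {u x} → u ~ x → (p : Walk T x v) → All (u ≢_) (vertices T p) → Unique (vertices T p) →
      All (λ y → y ≡ v ⊎ ¬ Leaf T y) (vertices T p)
    go e ε       _          _          = inj₁ refl ∷ []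
    go e (f ◅ p) (_ ∷ u∉) (x∉ ∷ uniq) =
      inj₂ (distinct-neighbours⇒¬leaf (~-sym e) f (All.lookup u∉ (head∈ T p))) ∷ go f p x∉ uniq

  -- A simple walk from vertex 0 to vertex 1 or 2 either passes through an internal vertex or is an
  -- edge; if both are edges, vertex 0 has two neighbours.
  internal-exists : 3 ℕ.≤ n → Connected T → ∃[ v ] ¬ Leaf T v
  internal-exists (s≤s (s≤s (s≤s _))) connected
    with internal⊎adjacent zero (suc zero) (λ ()) | internal⊎adjacent zero (suc (suc zero)) (λ ())
    where
    internal⊎adjacent : ∀ u v → u ≢ v → (∃[ x ] ¬ Leaf T x) ⊎ u ~ v
    internal⊎adjacent u v u≢v with simplify T (connected u v)
    ... | ε         , _                   = contradiction refl u≢v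
    ... | e ◅ ε     , _                   = inj₂ e
    ... | e ◅ f ◅ p , ((_ ∷ u∉) ∷ _) , _ =
      inj₁ (_ , distinct-neighbours⇒¬leaf (~-sym e) f (All.lookup u∉ (head∈ T p)))
  ... | inj₁ internal | _             = internal
  ... | inj₂ _        | inj₁ internal = internal
  ... | inj₂ e        | inj₂ f        = zero , distinct-neighbours⇒¬leaf e f λ ()

vertices-map : ∀ {n} (T G : Graph n) (T⊆G : T ⊆ G) {u v} (p : Walk T u v) →
  vertices G (Star.map T⊆G p) ≡ vertices T p
vertices-map T G T⊆G ε       = refl
vertices-map T G T⊆G (_ ◅ p) = cong (_ ∷_) (vertices-map T G T⊆G p)

-- Every vertex x weighs a power of two of its own, the leaves of T being so heavy that a walk
-- through internal vertices only costs less than radius, while an edge at a leaf costs at least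
-- twice the radius. Around an internal vertex s, the points at distance radius therefore lie
-- on the last edges of the shortest paths to the leaves of T, one on each, with at least
-- another radius to go.
module Construction {n} (G : Graph n) (connected : Connected G) (T : Graph n) (T⊆G : T ⊆ G)
  (T-connected : Connected T) (s : Fin n) (s-internal : ¬ Leaf T s) where
  open Graph G

  -- Internal exponents stay below `n`. The extra 2 pays for two doublings of `2 ^ n`: one from
  -- total to cost, which gives `radius`, and one to make leaves weigh at least twice the radius.
  offset : ∀ {p} {P : Set p} → Dec P → ℕ
  offset (yes _) = 2 ℕ.+ n
  offset (no  _) = 0

  exponent : Fin n → ℕ
  exponent x = offset (leaf? T x) ℕ.+ toℕ x

  exponent-injective : ∀ {x y} → exponent x ≡ exponent y → x ≡ y
  exponent-injective {x} {y} eq with leaf? T x | leaf? T y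
  ... | yes _ | yes _ = Fin.toℕ-injective (ℕ.+-cancelˡ-≡ (2 ℕ.+ n) _ _ eq)
  ... | no _  | no _  = Fin.toℕ-injective eq
  ... | yes _ | no _  = contradiction (Fin.toℕ<n y)
    (ℕ.≤⇒≯ (subst (n ℕ.≤_) eq (ℕ.≤-trans (ℕ.m≤n+m n 2) (ℕ.m≤m+n (2 ℕ.+ n) (toℕ x)))))
  ... | no _  | yes _ = contradiction (Fin.toℕ<n x)
    (ℕ.≤⇒≯ (subst (n ℕ.≤_) (sym eq) (ℕ.≤-trans (ℕ.m≤n+m n 2) (ℕ.m≤m+n (2 ℕ.+ n) (toℕ y)))))

  exponent-bound : ∀ x → exponent x ℕ.< 2 ℕ.+ n ℕ.+ n
  exponent-bound x with leaf? T x
  ... | yes _ = ℕ.+-monoʳ-< (2 ℕ.+ n) (Fin.toℕ<n x)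
  ... | no _  = ℕ.<-≤-trans (Fin.toℕ<n x) (ℕ.m≤n+m n (2 ℕ.+ n))

  internal-exponent : ∀ {x} → ¬ Leaf T x → exponent x ℕ.< n
  internal-exponent {x} internal with leaf? T x
  ... | yes leaf = contradiction leaf internal
  ... | no _     = Fin.toℕ<n x

  leaf-exponent : ∀ {x} → Leaf T x → 2 ℕ.+ n ℕ.≤ exponent x
  leaf-exponent {x} leaf with leaf? T x
  ... | yes _   = ℕ.m≤m+n (2 ℕ.+ n) (toℕ x)
  ... | no ¬leaf = contradiction leaf ¬leaf

  g : Fin n → ℕ
  g x = 2 ℕ.^ exponent x

  open VertexWeights G g (λ x → ℕ.m^n>0 2 (exponent x)) public

  total≡powers : ∀ xs → total xs ≡ powers (map exponent xs)
  total≡powers xs = cong sum (List.map-∘ xs)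

  unique : UniqueShortestPaths W
  unique = unique-shortest-paths λ {xs} {ys} uxs uys eq x∈ →
    let y , y∈ , eq′ = ∈.∈-map⁻ exponent
          (powers-injective
            (Unique.map⁺ exponent-injective uxs) (Unique.map⁺ exponent-injective uys)
            (bounded xs) (bounded ys) (trans (sym (total≡powers xs)) (trans eq (total≡powers ys)))
            (∈.∈-map⁺ exponent x∈))
    in subst (_∈ ys) (sym (exponent-injective eq′)) y∈
    where
    bounded : ∀ xs → All (ℕ._< 2 ℕ.+ n ℕ.+ n) (map exponent xs)
    bounded xs = All.map⁺ (All.universal exponent-bound xs)

  -- Distances from the root in the constructed graph

  open ShortestPathTree connected W unique s

  radius : ℕ
  radius = 2 ℕ.^ suc n

  double-2^ : ∀ m → 2 ℕ.^ m ℕ.+ 2 ℕ.^ m ≡ 2 ℕ.^ suc m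
  double-2^ m = cong (2 ℕ.^ m ℕ.+_) (sym (ℕ.+-identityʳ (2 ℕ.^ m)))

  leaf-g : ∀ {x} → Leaf T x → radius ℕ.+ radius ℕ.≤ g x
  leaf-g {x} leaf = subst (ℕ._≤ g x) (sym (double-2^ (suc n))) (ℕ.^-monoʳ-≤ 2 (leaf-exponent leaf))

  internal-g : ∀ {x} → ¬ Leaf T x → g x ℕ.≤ radius
  internal-g internal = ℕ.^-monoʳ-≤ 2 (ℕ.≤-trans (ℕ.<⇒≤ (internal-exponent internal)) (ℕ.n≤1+n n))

  -- A simple walk of `T` between internal vertices meets no leaf, so its total is a sum of distinct
  -- powers below `2 ^ n`, and its cost is less than twice that.
  dist-internal : ∀ {v} → ¬ Leaf T v → dist v < ι radius
  dist-internal {v} v-internal = begin-strict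
    dist v          ≤⟨ dist≤weight q ⟩
    weight W q      ≡⟨ weight≡cost q ⟩
    ι (cost q)      <⟨ ι-mono-< cost<radius ⟩
    ι radius        ∎
    where
    p : Walk T s v
    p = proj₁ (simplify T (T-connected s v))

    uniq : Unique (vertices T p)
    uniq = proj₁ (proj₂ (simplify T (T-connected s v)))

    q : Walk G s v
    q = Star.map T⊆G p

    exponents<n : All (ℕ._< n) (map exponent (vertices T p))
    exponents<n = All.map⁺ (All.map
      (λ { (inj₁ refl)     → internal-exponent v-internal
         ; (inj₂ internal) → internal-exponent internal })
      (simple⇒internal T p uniq s-internal))

    total<2^n : total (vertices G q) ℕ.< 2 ℕ.^ n
    total<2^n = subst (ℕ._< 2 ℕ.^ n)
      (sym (trans (cong total (vertices-map T G T⊆G p)) (total≡powers (vertices T p))))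
      (powers-< (Unique.map⁺ exponent-injective uniq) exponents<n)

    cost<radius : cost q ℕ.< radius
    cost<radius = begin-strict
      cost q                                          ≤⟨ ℕ.m≤m+n (cost q) (g s ℕ.+ g v) ⟩
      cost q ℕ.+ (g s ℕ.+ g v)                        ≡⟨ cost+ends q ⟩
      total (vertices G q) ℕ.+ total (vertices G q)   <⟨ ℕ.+-mono-< total<2^n total<2^n ⟩
      2 ℕ.^ n ℕ.+ 2 ℕ.^ n                             ≡⟨ double-2^ n ⟩
      radius                                          ∎
      where open ℕ.≤-Reasoning
    open ℚ.≤-Reasoning

  leaf≢root : ∀ {w} → Leaf T w → s ≢ w
  leaf≢root leaf refl = s-internal leaf

  dist-leaf : ∀ {w} → Leaf T w → ι (g w) ≤ℚ dist w
  dist-leaf {w} leaf = begin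
    ι (g w)           ≤⟨ ι-mono-≤ (ℕ.≤-trans (ℕ.m≤n+m (g w) (g s)) (ends≤cost p (leaf≢root leaf))) ⟩
    ι (cost p)        ≡⟨ weight≡cost p ⟨
    weight W p        ∎
    where
    open ℚ.≤-Reasoning
    p : Walk G s w
    p = proj₁ (shortest-exists G W (connected s w))

  internal-neighbour : ∀ {w} → Leaf T w → ∃[ y ] (¬ Leaf T y × y ~ w)
  internal-neighbour {w} leaf with simplify T (T-connected s w)
  ... | p , uniq , _ with lastStep T p
  ...   | none = contradiction leaf s-internal
  ...   | _▻_ {y} q e with All.lookup (simple⇒internal T p uniq s-internal)
                            (subst (y ∈_) (sym (vertices-◅◅ T q e ε)) (∈.∈-++⁺ˡ (last∈ T q)))
  ...     | inj₁ refl     = contradiction e (Graph.~-irr T refl)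
  ...     | inj₂ internal = y , internal , T⊆G e

  -- Entering `w` from its internal neighbour `y` in `T` is cheaper: `y` is within `radius` of the
  -- root, while a leaf `u` is already at least twice as far and also heavier than `y`.
  arc-into-leaf : ∀ {u w} → Leaf T w → Arc W s u w → ¬ Leaf T u
  arc-into-leaf {u} {w} w-leaf a u-leaf = ℚ.<-irrefl refl (begin-strict
    dist w                                    ≤⟨ dist-edge e ⟩
    dist y + ι (g y ℕ.+ g w)                  <⟨ ℚ.+-monoˡ-< (ι (g y ℕ.+ g w))
                                                   (dist-internal y-internal) ⟩
    ι radius + ι (g y ℕ.+ g w)                ≡⟨ ι-+ radius (g y ℕ.+ g w) ⟨
    ι (radius ℕ.+ (g y ℕ.+ g w))              ≤⟨ ι-mono-≤ detour-bound ⟩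
    ι (g u ℕ.+ (g u ℕ.+ g w))                 ≡⟨ ι-+ (g u) (g u ℕ.+ g w) ⟩
    ι (g u) + ι (g u ℕ.+ g w)                 ≤⟨ ℚ.+-monoˡ-≤ (ι (g u ℕ.+ g w)) (dist-leaf u-leaf) ⟩
    dist u + ι (g u ℕ.+ g w)                  ≡⟨ arc-dist a ⟨
    dist w                                    ∎)
    where
    y : Fin n
    y = proj₁ (internal-neighbour w-leaf)

    y-internal : ¬ Leaf T y
    y-internal = proj₁ (proj₂ (internal-neighbour w-leaf))

    e : y ~ w
    e = proj₂ (proj₂ (internal-neighbour w-leaf))

    detour-bound : radius ℕ.+ (g y ℕ.+ g w) ℕ.≤ g u ℕ.+ (g u ℕ.+ g w)
    detour-bound = ℕ.+-mono-≤
      (ℕ.≤-trans (ℕ.m≤m+n radius radius) (leaf-g u-leaf))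
      (ℕ.+-monoˡ-≤ (g w) (ℕ.≤-trans (internal-g y-internal)
        (ℕ.≤-trans (ℕ.m≤m+n radius radius) (leaf-g u-leaf))))
    open ℚ.≤-Reasoning

  -- The cut at `radius` and its bijection with the leaves of `T`

  cut⇒leaf : ∀ {x} → Cut W s (ι radius) x → Leaf T (bottom x)
  cut⇒leaf {x} (_ , x-level) =
    decidable-stable (leaf? T (bottom x)) λ internal → ℚ.<-irrefl refl (begin-strict
      ι radius          ≡⟨ root-descent-height x-level ⟨
      height x          ≤⟨ height≤bottom x ⟩
      dist (bottom x)   <⟨ dist-internal internal ⟩
      ι radius          ∎)
    where open ℚ.≤-Reasoning

  0≤radius : 0ℚ ≤ℚ ι radius
  0≤radius = ι-mono-≤ {0} {radius} z≤n

  arc-into-leaf⇒cut : ∀ {u w} → Leaf T w → Ancestor s u → Arc W s u w →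
    ∃[ x ] (Cut W s (ι radius) x × bottom x ≡ w)
  arc-into-leaf⇒cut {u} {w} w-leaf s⇝u a =
    x , ((ι radius , x-level , node w , _ , x⇝w , long-tail) , x-level) , refl
    where
    ℓ : ℚ
    ℓ = ι (g u ℕ.+ g w)

    α : ℚ
    α = ι radius - dist u

    u+α : dist u + α ≡ ι radius
    u+α = solve 2 (λ u r → u :+ (r :- u) := r) refl (dist u) (ι radius)
      where open +-*-Solver

    2radius≤w : ι radius + ι radius ≤ℚ dist w
    2radius≤w = begin
      ι radius + ι radius     ≡⟨ ι-+ radius radius ⟨
      ι (radius ℕ.+ radius)   ≤⟨ ι-mono-≤ (leaf-g w-leaf) ⟩
      ι (g w)                 ≤⟨ dist-leaf w-leaf ⟩
      dist w                  ∎
      where open ℚ.≤-Reasoning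

    0<α : 0ℚ < α
    0<α = +-cancelˡ-< (dist u) (begin-strict
      dist u + 0ℚ   ≡⟨ ℚ.+-identityʳ (dist u) ⟩
      dist u        <⟨ dist-internal (arc-into-leaf w-leaf a) ⟩
      ι radius      ≡⟨ u+α ⟨
      dist u + α    ∎)
      where open ℚ.≤-Reasoning

    α<ℓ : α < ℓ
    α<ℓ = +-cancelˡ-< (dist u) (begin-strict
      dist u + α            ≡⟨ u+α ⟩
      ι radius              ≡⟨ ℚ.+-identityʳ (ι radius) ⟨
      ι radius + 0ℚ         <⟨ ℚ.+-monoʳ-< (ι radius) (ι-mono-< {0} (ℕ.m^n>0 2 (suc n))) ⟩
      ι radius + ι radius   ≤⟨ 2radius≤w ⟩
      dist w                ≡⟨ arc-dist a ⟩
      dist u + ℓ            ∎)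
      where open ℚ.≤-Reasoning

    x : Point W s
    x = inner u w α a 0<α α<ℓ

    x-level : Descent W s (node s) x (ι radius)
    x-level =
      let _ , s⇝ = ancestor⇒descent stay s⇝u
          s⇝x    = move s⇝ a start inside (ℚ.<⇒≤ 0<α)
      -- `ancestor⇒descent` leaves the length unspecified; the height of `x` identifies it as
      -- `ι radius`.
      in subst (Descent W s (node s) x) (trans (sym (root-descent-height s⇝x)) u+α) s⇝x

    x⇝w : Descent W s x (node w) (0ℚ + (ℓ - α))
    x⇝w = move stay a inside end (ℚ.<⇒≤ α<ℓ)

    long-tail : ½ * ι radius ≤ℚ 0ℚ + (ℓ - α)
    -- With `ι radius` added, the right side becomes `dist w`, which is at least twice the radius.
    long-tail = +-cancelˡ-≤ (ι radius) (begin
      ι radius + ½ * ι radius          ≤⟨ ℚ.+-monoʳ-≤ (ι radius) half≤ ⟩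
      ι radius + ι radius              ≤⟨ 2radius≤w ⟩
      dist w                           ≡⟨ descent-height x⇝w ⟩
      dist u + α + (0ℚ + (ℓ - α))      ≡⟨ cong (_+ (0ℚ + (ℓ - α))) u+α ⟩
      ι radius + (0ℚ + (ℓ - α))        ∎)
      where
      open ℚ.≤-Reasoning
      half≤ : ½ * ι radius ≤ℚ ι radius
      half≤ = subst (½ * ι radius ≤ℚ_) (ℚ.*-identityˡ (ι radius))
        (ℚ.*-monoʳ-≤-nonNeg (ι radius) {{nonNegative 0≤radius}} (from-yes (½ ℚ.≤? 1ℚ)))

  leaf⇒cut : ∀ {w} → Leaf T w → ∃[ x ] (Cut W s (ι radius) x × bottom x ≡ w)
  leaf⇒cut {w} w-leaf =
    [ (λ s≡w → contradiction s≡w (leaf≢root w-leaf))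
    , (λ (u , s⇝u , a) → arc-into-leaf⇒cut w-leaf s⇝u a)
    ]′ (ancestor-last (root-ancestor w))

  cut-size : ∀ {ml} → HasSize (Leaf T) ml → HasSize (Cut W s (ι radius)) ml
  cut-size = hasSize-via bottom cut⇒leaf
    (λ {x} {x′} (_ , lx) (_ , lx′) →
      point-ext x x′ (trans (root-descent-height lx) (sym (root-descent-height lx′))))
    leaf⇒cut

theorem15 : (∀ {n : ℕ} (G : Graph n) → Connected G →
    (W : Weights G) → UniqueShortestPaths W →
    ∀ (κ ml : ℕ) → IsSkeletonDimension W κ → IsMaxLeafNumber G ml →
    κ ≤ ml)
    × (∀ {n : ℕ} (G : Graph n) → Connected G → 3 ≤ n →
    ∀ (ml : ℕ) → IsMaxLeafNumber G ml →
    Σ[ W ∈ Weights G ]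
    (UniqueShortestPaths W × IsMetric W × IsSkeletonDimension W ml))
theorem15 =
  (λ G connected W unique κ ml ((s , r , _ , size) , _) isMax →
    ShortestPathTree.cut-≤-maxLeafNumber connected W unique s isMax size) ,
  λ G connected 3≤n ml isMax@((T , (T⊆G , T-connected , _) , leaves) , _) →
    let s , s-internal = internal-exists T 3≤n T-connected
        open Construction G connected T T⊆G T-connected s s-internal
    in W , unique , metric ,
       (s , ι radius , 0≤radius , cut-size leaves) ,
       -- The upper bound, applied to the constructed weights, shows that no cut exceeds the one
       -- just exhibited.
       λ s′ r k _ size → ShortestPathTree.cut-≤-maxLeafNumber connected W unique s′ isMax size
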